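{- The double domination number of the fractal cubic network $FCN(1)$ is $\gamma_{\times 2}(FCN(1)) = 12$.
   Context: Fractal cubic network: for an integer $l\ge 0$, $FCN(l)$ is the finite simple graph whose vertices are all binary strings of length $2l+2$, defined recursively as follows. $FCN(0)$ is the 4-cycle with vertices $00, 01, 11, 10$ in this cyclic order. For $l\ge 1$, $FCN(l)$ is obtained from the disjoint union of the four copies $ab\,\Vert\,FCN(l-1)$, $a,b\in\{0,1\}$ (each vertex string of $FCN(l-1)$ is prefixed by $ab$, adjacency inside a copy being that of $FCN(l-1)$), by adding the four edges $\{00w,10w\}$, $\{10w,11w\}$, $\{11w,01w\}$, $\{01w,00w\}$, where $w=10(01)^{l-1}$ is the string $10$ followed by $l-1$ repetitions of $01$. A double dominating set of a graph $\Gamma$ is a set $D\subseteq V(\Gamma)$ such that $|N[v]\cap D|\ge 2$ for every $v\in V(\Gamma)$, where $N[v]$ is the closed neighborhood of $v$; $\gamma_{\times 2}(\Gamma)$ is the minimum size of a double dominating set. -}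

module Defs where

open import Data.Bool.Base using (Bool; _∧_; _∨_)
open import Data.Digit using (Bit; 0b; 1b)
import Data.Fin.Properties as Fin
open import Data.List.Base
  using (List; []; _∷_; length; filterᵇ; allFin; cartesianProductWith)
open import Data.List.Membership.Propositional using (_∈_)
import Data.List.Membership.DecPropositional as DecMembership
open import Data.List.Membership.Propositional.Properties
  using (∈-allFin; ∈-cartesianProductWith⁺)
open import Data.List.Relation.Unary.All using ([])
open import Data.List.Relation.Unary.AllPairs using ([]; _∷_)
open import Data.List.Relation.Unary.Any using (here; there)
open import Data.List.Relation.Unary.Unique.Propositional using (Unique)
open import Data.List.Relation.Unary.Unique.Propositional.Properties
  using (allFin⁺; cartesianProductWith⁺)
open import Data.Nat.Base using (ℕ; zero; suc; _+_; _*_; _≤_)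
open import Data.Product.Base using (_×_; _,_; ∃-syntax)
import Data.Product.Properties as Product
open import Data.Sum.Base using (_⊎_; inj₁; inj₂; swap)
open import Data.Vec.Base as Vec using (Vec; []; _∷_)
import Data.Vec.Properties as Vec
open import Level using (0ℓ)
open import Relation.Binary.Core using (Rel)
open import Relation.Binary.Definitions using (Decidable; DecidableEquality; Symmetric)
open import Relation.Binary.PropositionalEquality.Core using (_≡_; refl; sym)
open import Relation.Nullary.Decidable.Core using (does; _×-dec_; _⊎-dec_)
open import Relation.Nullary.Negation.Core using (¬_)

record FiniteSimpleGraph : Set₁ where
  infix 4 _≟_ _~_ _~?_
  field
    Vertex   : Set
    _≟_      : DecidableEquality Vertex
    vertices : List Vertex
    unique   : Unique vertices
    complete : ∀ v → v ∈ vertices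
    _~_      : Rel Vertex 0ℓ
    _~?_     : Decidable _~_
    ~-sym    : Symmetric _~_
    ~-irrefl : ∀ v → ¬ (v ~ v)

  VertexSet : Set
  VertexSet = Vertex → Bool

  ∣_∣ : VertexSet → ℕ
  ∣ D ∣ = length (filterᵇ D vertices)

  infixr 7 _∩_
  _∩_ : VertexSet → VertexSet → VertexSet
  (D ∩ E) u = D u ∧ E u

  N[_] : Vertex → VertexSet
  N[ v ] u = does (u ≟ v) ∨ does (u ~? v)

  IsDoubleDominating : VertexSet → Set
  IsDoubleDominating D = ∀ v → 2 ≤ ∣ N[ v ] ∩ D ∣

-- γ×2(Γ) = n is a relation, since a graph with an isolated vertex has no
-- double dominating set.
IsDoubleDominationNumber : FiniteSimpleGraph → ℕ → Set
IsDoubleDominationNumber Γ n =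
  (∃[ D ] IsDoubleDominating D × ∣ D ∣ ≡ n) ×
  (∀ D → IsDoubleDominating D → n ≤ ∣ D ∣)
  where open FiniteSimpleGraph Γ

infix 4 _≟ˢ_
_≟ˢ_ : ∀ {n} → DecidableEquality (Vec Bit n)
_≟ˢ_ = Vec.≡-dec Fin._≟_

strings : ∀ n → List (Vec Bit n)
strings zero    = [] ∷ []
strings (suc n) = cartesianProductWith _∷_ (allFin 2) (strings n)

strings-unique : ∀ n → Unique (strings n)
strings-unique zero    = [] ∷ []
strings-unique (suc n) =
  cartesianProductWith⁺ _∷_ Vec.∷-injective (allFin⁺ 2) (strings-unique n)

strings-complete : ∀ {n} (s : Vec Bit n) → s ∈ strings n
strings-complete []      = here refl
strings-complete (b ∷ s) =
  ∈-cartesianProductWith⁺ _∷_ (∈-allFin b) (strings-complete s)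

-- The 4-cycle 00, 01, 11, 10.  It is FCN(0), and it is also the pattern in
-- which the four copies of FCN(l-1) are joined in FCN(l).
cycleEdges : List (Vec Bit 2 × Vec Bit 2)
cycleEdges =
  (0b ∷ 0b ∷ [] , 0b ∷ 1b ∷ []) ∷
  (0b ∷ 1b ∷ [] , 1b ∷ 1b ∷ []) ∷
  (1b ∷ 1b ∷ [] , 1b ∷ 0b ∷ []) ∷
  (1b ∷ 0b ∷ [] , 0b ∷ 0b ∷ []) ∷ []

C₄ : Rel (Vec Bit 2) 0ℓ
C₄ p q = (p , q) ∈ cycleEdges ⊎ (q , p) ∈ cycleEdges

C₄? : Decidable C₄
C₄? p q = ((p , q) ∈? cycleEdges) ⊎-dec ((q , p) ∈? cycleEdges)
  where open DecMembership (Product.≡-dec (_≟ˢ_ {2}) (_≟ˢ_ {2})) using (_∈?_)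

loop∉cycleEdges : ∀ p → ¬ ((p , p) ∈ cycleEdges)
loop∉cycleEdges p (here ())
loop∉cycleEdges p (there (here ()))
loop∉cycleEdges p (there (there (here ())))
loop∉cycleEdges p (there (there (there (here ()))))

C₄-irrefl : ∀ p → ¬ C₄ p p
C₄-irrefl p (inj₁ e) = loop∉cycleEdges p e
C₄-irrefl p (inj₂ e) = loop∉cycleEdges p e

-- Written so that FCNVertex (suc l) is definitionally Vec Bit (2 + (2 + l * 2)).
FCNVertex : ℕ → Set
FCNVertex l = Vec Bit (2 + l * 2)

-- The string 10(01)^l, through which the copies of FCN(l) are joined in FCN(l+1).
port : ∀ l → FCNVertex l
port l = 1b ∷ 0b ∷ Vec.concat (Vec.replicate l (0b ∷ 1b ∷ []))

FCNAdj : ∀ l → Rel (FCNVertex l) 0ℓ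
FCNAdj zero    u v = C₄ u v
FCNAdj (suc l) (a ∷ b ∷ u) (c ∷ d ∷ v) =
  (a ≡ c × b ≡ d × FCNAdj l u v) ⊎
  (C₄ (a ∷ b ∷ []) (c ∷ d ∷ []) × u ≡ port l × v ≡ port l)

FCNAdj? : ∀ l → Decidable (FCNAdj l)
FCNAdj? zero    u v = C₄? u v
FCNAdj? (suc l) (a ∷ b ∷ u) (c ∷ d ∷ v) =
  ((a Fin.≟ c) ×-dec (b Fin.≟ d) ×-dec FCNAdj? l u v) ⊎-dec
  (C₄? (a ∷ b ∷ []) (c ∷ d ∷ []) ×-dec (u ≟ˢ port l) ×-dec (v ≟ˢ port l))

FCNAdj-sym : ∀ l {u v} → FCNAdj l u v → FCNAdj l v u
FCNAdj-sym zero e = swap e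
FCNAdj-sym (suc l) {_ ∷ _ ∷ _} {_ ∷ _ ∷ _} (inj₁ (p , q , e)) = inj₁ (sym p , sym q , FCNAdj-sym l e)
FCNAdj-sym (suc l) {_ ∷ _ ∷ _} {_ ∷ _ ∷ _} (inj₂ (e , p , q)) = inj₂ (swap e , q , p)

FCNAdj-irrefl : ∀ l v → ¬ FCNAdj l v v
FCNAdj-irrefl zero    v           e                  = C₄-irrefl v e
FCNAdj-irrefl (suc l) (a ∷ b ∷ v) (inj₁ (_ , _ , e)) = FCNAdj-irrefl l v e
FCNAdj-irrefl (suc l) (a ∷ b ∷ v) (inj₂ (e , _))     = C₄-irrefl (a ∷ b ∷ []) e

FCN : ℕ → FiniteSimpleGraph
FCN l = record
  { Vertex   = FCNVertex l
  ; _≟_      = _≟ˢ_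
  ; vertices = strings (2 + l * 2)
  ; unique   = strings-unique (2 + l * 2)
  ; complete = strings-complete
  ; _~_      = FCNAdj l
  ; _~?_     = FCNAdj? l
  ; ~-sym    = FCNAdj-sym l
  ; ~-irrefl = FCNAdj-irrefl l
  }

{-# OPTIONS --safe #-}

-- In each copy ab‖FCN(0) of FCN(1), the three vertices other than the port ab10
-- have their closed neighbourhoods inside the copy. Dominating these doubly takes
-- three vertices of the copy: a closed neighbourhood in a 4-cycle omits one vertex,
-- these three omit distinct ones, so they have no two vertices in common. Hence at
-- least 4 · 3 vertices are needed, and omitting one neighbour of the port in every
-- copy attains this.
module Submission where

open import Defs

open import Data.Bool.Base using (Bool; true; false; _∧_)
open import Data.Digit using (Bit; 0b; 1b)
open import Data.Fin.Base using (zero; suc)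
open import Data.List.Base using (List; []; _∷_; _++_; length; filterᵇ; map)
open import Data.List.Relation.Unary.All using (all?; lookup)
open import Data.Nat.Base using (_+_; _≤_; z≤n; s≤s)
open import Data.Nat.Properties using (_≤?_; m≤n⇒m≤1+n)
open import Data.Product.Base using (_,_)
open import Data.Vec.Base using ([]; _∷_)
open import Relation.Binary.PropositionalEquality using (_≡_; refl; cong; subst)
open import Relation.Nullary.Decidable using (toWitness)

open FiniteSimpleGraph (FCN 1)

filterᵇ-∧ : ∀ {A : Set} (p q : A → Bool) xs →
  filterᵇ (λ x → p x ∧ q x) xs ≡ filterᵇ q (filterᵇ p xs)
filterᵇ-∧ p q [] = refl
filterᵇ-∧ p q (x ∷ xs) with p x
... | false = filterᵇ-∧ p q xs
... | true with q x
...   | false = filterᵇ-∧ p q xs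
...   | true  = cong (x ∷_) (filterᵇ-∧ p q xs)

count-++-mono : ∀ {A : Set} (p : A → Bool) {m n} xs {ys} →
  m ≤ length (filterᵇ p xs) → n ≤ length (filterᵇ p ys) →
  m + n ≤ length (filterᵇ p (xs ++ ys))
count-++-mono p []       z≤n n≤ = n≤
count-++-mono p (x ∷ xs) m≤  n≤ with p x
... | false = count-++-mono p xs m≤ n≤
count-++-mono p (x ∷ xs) z≤n      n≤ | true = m≤n⇒m≤1+n (count-++-mono p xs z≤n n≤)
count-++-mono p (x ∷ xs) (s≤s m≤) n≤ | true = s≤s (count-++-mono p xs m≤ n≤)

-- The three triples omit `z`, `y` and `w` in turn and share only `x`. If just two positions were
-- selected, one of them would be among these three, and the triple omitting it would hold at most
-- one.
3≤count : ∀ {A : Set} (p : A → Bool) w x y z →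
  2 ≤ length (filterᵇ p (w ∷ x ∷ y ∷ [])) →
  2 ≤ length (filterᵇ p (w ∷ x ∷ z ∷ [])) →
  2 ≤ length (filterᵇ p (x ∷ y ∷ z ∷ [])) →
  3 ≤ length (filterᵇ p (w ∷ x ∷ y ∷ z ∷ []))
3≤count p w x y z with p w
3≤count p w x y z | true with p x
3≤count p w x y z | true | true with p y
3≤count p w x y z | true | true | true = λ _ _ _ → s≤s (s≤s (s≤s z≤n))
3≤count p w x y z | true | true | false with p z
3≤count p w x y z | true | true | false | true  = λ _ _ _ → s≤s (s≤s (s≤s z≤n))
3≤count p w x y z | true | true | false | false = λ { _ _ (s≤s ()) }
3≤count p w x y z | true | false with p y
3≤count p w x y z | true | false | false = λ { (s≤s ()) }
3≤count p w x y z | true | false | true with p z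
3≤count p w x y z | true | false | true | true  = λ _ _ _ → s≤s (s≤s (s≤s z≤n))
3≤count p w x y z | true | false | true | false = λ { _ (s≤s ()) }
3≤count p w x y z | false with p x
3≤count p w x y z | false | true with p y
3≤count p w x y z | false | true | false = λ { (s≤s ()) }
3≤count p w x y z | false | true | true with p z
3≤count p w x y z | false | true | true | true  = λ _ _ _ → s≤s (s≤s (s≤s z≤n))
3≤count p w x y z | false | true | true | false = λ { _ (s≤s ()) }
3≤count p w x y z | false | false with p y
3≤count p w x y z | false | false | true  = λ { (s≤s ()) }
3≤count p w x y z | false | false | false = λ { () }

-- Filtering by `N[ v ]` first lets the inner list evaluate for a concrete `v` while `D` stays
-- abstract.
2≤neighbours : ∀ D → IsDoubleDominating D → ∀ v →
  2 ≤ length (filterᵇ D (filterᵇ N[ v ] vertices))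
2≤neighbours D dom v = subst (λ us → 2 ≤ length us) (filterᵇ-∧ N[ v ] D vertices) (dom v)

copy : Bit → Bit → List Vertex
copy a b = map (λ s → a ∷ b ∷ s) (strings 2)

-- In the order 00, 01, 10, 11 of `strings 2`, the closed neighbourhoods of 00, 01, 11 omit 11, 10,
-- 00, as `3≤count` requires. Fixing both bits makes them compute.
3≤copy : ∀ D → IsDoubleDominating D → ∀ a b → 3 ≤ length (filterᵇ D (copy a b))
3≤copy D dom zero zero = 3≤count D _ _ _ _
    (2≤neighbours D dom (0b ∷ 0b ∷ 0b ∷ 0b ∷ []))
    (2≤neighbours D dom (0b ∷ 0b ∷ 0b ∷ 1b ∷ []))
    (2≤neighbours D dom (0b ∷ 0b ∷ 1b ∷ 1b ∷ []))
3≤copy D dom zero (suc zero) = 3≤count D _ _ _ _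
    (2≤neighbours D dom (0b ∷ 1b ∷ 0b ∷ 0b ∷ []))
    (2≤neighbours D dom (0b ∷ 1b ∷ 0b ∷ 1b ∷ []))
    (2≤neighbours D dom (0b ∷ 1b ∷ 1b ∷ 1b ∷ []))
3≤copy D dom (suc zero) zero = 3≤count D _ _ _ _
    (2≤neighbours D dom (1b ∷ 0b ∷ 0b ∷ 0b ∷ []))
    (2≤neighbours D dom (1b ∷ 0b ∷ 0b ∷ 1b ∷ []))
    (2≤neighbours D dom (1b ∷ 0b ∷ 1b ∷ 1b ∷ []))
3≤copy D dom (suc zero) (suc zero) = 3≤count D _ _ _ _
    (2≤neighbours D dom (1b ∷ 1b ∷ 0b ∷ 0b ∷ []))
    (2≤neighbours D dom (1b ∷ 1b ∷ 0b ∷ 1b ∷ []))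
    (2≤neighbours D dom (1b ∷ 1b ∷ 1b ∷ 1b ∷ []))

12≤∣D∣ : ∀ D → IsDoubleDominating D → 12 ≤ ∣ D ∣
12≤∣D∣ D dom =
  -- In lexicographic order the copies are consecutive blocks, so `vertices` evaluates to their
  -- concatenation.
  count-++-mono D (copy 0b 0b) (3≤copy D dom 0b 0b)
  (count-++-mono D (copy 0b 1b) (3≤copy D dom 0b 1b)
  (count-++-mono D (copy 1b 0b) (3≤copy D dom 1b 0b) (3≤copy D dom 1b 1b)))

notLast11 : VertexSet
notLast11 (_ ∷ _ ∷ suc zero ∷ suc zero ∷ []) = false
notLast11 _ = true

-- Within its copy a vertex has three closed neighbours, of which at most one is dropped.
notLast11-dominating : IsDoubleDominating notLast11
notLast11-dominating v =
  -- All sixteen vertices are checked by evaluating the decision procedure.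
  lookup (toWitness {a? = all? (λ u → 2 ≤? ∣ N[ u ] ∩ notLast11 ∣) vertices} _) (complete v)

theorem24 : IsDoubleDominationNumber (FCN 1) 12
theorem24 = (notLast11 , notLast11-dominating , refl) , 12≤∣D∣
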